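{- Let $G$ be a super edge-magic graph that contains a cycle, with $|E(G)| = 2|V(G)|-5$ and girth $g(G)\ge 5$. Then $|\sigma_G| = 1$, where $\sigma_G$ is the super edge-magic set of $G$.
   Context: Graphs are finite and simple. The notation $[a,b]$ denotes the set of integers $x$ with $a\le x\le b$. An edge-magic labeling of a graph $G$ is a bijection $f:V(G)\cup E(G)\to[1,|V(G)|+|E(G)|]$ such that $f(u)+f(v)+f(uv)$ equals a constant (the valence $\mathrm{val}(f)$ of $f$) for every $uv\in E(G)$. It is super edge-magic if moreover $f(V(G))=[1,|V(G)|]$, and $G$ is super edge-magic if it admits a super edge-magic labeling. For a graph $G$ of order $p$ and size $q$ (with $q\geq 1$), let $$S_G=\left\{\frac{\sum_{u\in V(G)}\deg(u)g(u)+\sum_{i=p+1}^{p+q} i}{q} : g:V(G)\to[1,p]\text{ bijective}\right\}.$$ If $\lceil\min S_G\rceil\le\lfloor\max S_G\rfloor$, the super edge-magic interval of $G$ is $I_G=[\lceil\min S_G\rceil,\lfloor\max S_G\rfloor]$. The super edge-magic set of $G$ is $$\sigma_G=\{k\in I_G : \text{there exists a super edge-magic labeling of } G\text{ with valence } k\}.$$ The girth of a graph that contains a cycle is the length of its shortest cycle; it is defined only for graphs containing a cycle. -}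

module Defs where

open import Level using (0ℓ)
open import Data.Nat.Base using (ℕ; suc; _+_; _*_; _≤_; NonZero)
open import Data.Fin.Base as Fin using (Fin)
open import Data.Fin.Properties using (_<?_)
open import Data.Integer.Base as ℤ using (ℤ; +_)
open import Data.Rational.Base as ℚ using (ℚ; floor; ceiling)
open import Data.List.Base
  using (List; []; _∷_; _∷ʳ_; length; map; sum; filter; upTo; allFin; cartesianProduct)
open import Data.List.Membership.Propositional using (_∈_)
open import Data.List.Relation.Unary.Linked using (Linked)
open import Data.List.Relation.Unary.Unique.Propositional using (Unique)
open import Data.Product.Base using (_×_; _,_; Σ-syntax; ∃-syntax)
open import Data.Sum.Base using (_⊎_; inj₁; inj₂)
open import Data.Empty using (⊥)
open import Function.Base using (flip; _∘_)
open import Function.Bundles using (_⇔_)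
open import Function.Definitions using (Injective)
open import Relation.Nullary.Decidable using (_×-dec_)
open import Relation.Unary using (Pred)
open import Relation.Binary.Core using (Rel)
open import Relation.Binary.Definitions using (Decidable; Symmetric; Irreflexive)
open import Relation.Binary.PropositionalEquality using (_≡_)

[_,_] : ℕ → ℕ → Pred ℕ 0ℓ
[ a , b ] x = a ≤ x × x ≤ b

BijectiveOnto : {A B : Set} → Pred B 0ℓ → (A → B) → Set
BijectiveOnto S f =
  (∀ x → S (f x)) × Injective _≡_ _≡_ f × (∀ y → S y → ∃[ x ] f x ≡ y)

IsMin : {A : Set} → Rel A 0ℓ → Pred A 0ℓ → Pred A 0ℓ
IsMin _≼_ P m = P m × (∀ x → P x → m ≼ x)

IsMax : {A : Set} → Rel A 0ℓ → Pred A 0ℓ → Pred A 0ℓ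
IsMax _≼_ = IsMin (flip _≼_)

HasCardinality : {A : Set} → Pred A 0ℓ → ℕ → Set
HasCardinality {A} P n =
  Σ[ xs ∈ List A ] Unique xs × length xs ≡ n × (∀ x → x ∈ xs ⇔ P x)

record Graph : Set₁ where
  infix 4 _~_ _~?_
  field
    order    : ℕ
    _~_      : Rel (Fin order) 0ℓ
    _~?_     : Decidable _~_
    ~-sym    : Symmetric _~_
    ~-irrefl : Irreflexive _≡_ _~_

  V : Set
  V = Fin order

  -- An unordered edge uv is represented once, by its endpoints in increasing
  -- order; the irrelevant fields make an edge determined by its endpoints.
  record E : Set where
    constructor edge
    field
      src tgt  : V
      .src<tgt : src Fin.< tgt
      .src~tgt : src ~ tgt

  size : ℕ
  size = length (filter (λ (u , v) → (u <? v) ×-dec (u ~? v))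
                        (cartesianProduct (allFin order) (allFin order)))

  deg : V → ℕ
  deg u = length (filter (u ~?_) (allFin order))

  -- A cycle is listed without repeating its starting vertex at the end.
  IsCycle : Pred (List V) 0ℓ
  IsCycle []        = ⊥
  IsCycle c@(v ∷ _) = 3 ≤ length c × Unique c × Linked _~_ (c ∷ʳ v)

  ContainsCycle : Set
  ContainsCycle = ∃[ c ] IsCycle c

  IsGirth : Pred ℕ 0ℓ
  IsGirth = IsMin _≤_ (λ n → ∃[ c ] IsCycle c × length c ≡ n)

  HasValence : (V ⊎ E → ℕ) → ℤ → Set
  HasValence f k =
    ∀ (e : E) → + (f (inj₁ (E.src e)) + f (inj₁ (E.tgt e)) + f (inj₂ e)) ≡ k

  IsEdgeMagicLabeling : Pred (V ⊎ E → ℕ) 0ℓ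
  IsEdgeMagicLabeling f =
    BijectiveOnto [ 1 , order + size ] f × (∃[ k ] HasValence f k)

  IsSuperEdgeMagicLabeling : Pred (V ⊎ E → ℕ) 0ℓ
  IsSuperEdgeMagicLabeling f =
    IsEdgeMagicLabeling f ×
    (∀ x → (∃[ v ] f (inj₁ v) ≡ x) ⇔ [ 1 , order ] x)

  IsSuperEdgeMagic : Set
  IsSuperEdgeMagic = ∃[ f ] IsSuperEdgeMagicLabeling f

  SNumerator : (V → ℕ) → ℕ
  SNumerator g =
    sum (map (λ u → deg u * g u) (allFin order)) +
    sum (map (λ i → order + suc i) (upTo size))

  -- S_G is defined only for graphs with at least one edge;
  -- the NonZero component makes it empty otherwise.
  S : Pred ℚ 0ℓ
  S s = Σ[ q≢0 ∈ NonZero size ] Σ[ g ∈ (V → ℕ) ]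
        BijectiveOnto [ 1 , order ] g ×
        s ≡ ℚ._/_ (+ SNumerator g) size {{q≢0}}

  -- Empty when ⌈min S_G⌉ > ⌊max S_G⌋.
  I : Pred ℤ 0ℓ
  I k = ∃[ m ] ∃[ M ]
        IsMin ℚ._≤_ S m × IsMax ℚ._≤_ S M ×
        ceiling m ℤ.≤ k × k ℤ.≤ floor M

  σ : Pred ℤ 0ℓ
  σ k = I k × (∃[ f ] IsSuperEdgeMagicLabeling f × HasValence f k)

{-# OPTIONS --safe #-}
module Submission where

-- Let p = order, q = size. Since the q = 2p ∸ 5 edge labels of a super edge-magic
-- labeling are the integers from p + 1 to p + q, the sums of adjacent vertex labels
-- are q consecutive integers s, …, s + q ∸ 1 between 3 and 2p ∸ 1, where the valence
-- is p + q + s; hence s is 3, 4 or 5. If s = 3, absence of triangles forces the sums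
-- 3, 4, …, p + 1 to be realised by edges at the vertex labelled 1, which is then
-- adjacent to every other vertex, and the edge of sum p + 2 closes a triangle. The
-- case s = 5 is the mirror image under x ↦ p + 1 ∸ x. So the valence is p + q + 4.
-- Summing the valence over all edges shows that it belongs to S, hence to I.

open import Defs
open import Data.Empty using (⊥; ⊥-elim)
open import Data.Fin.Base as Fin using (Fin; toℕ; fromℕ<)
open import Data.Fin.Properties as Fin using (all?; any?; injective⇒≤; toℕ-fromℕ<; toℕ<n)
open import Data.Integer.Base as ℤ using (ℤ; +_; -[1+_])
import Data.Integer.DivMod as ℤ
import Data.Integer.Properties as ℤ
open import Data.List.Base
  using (List; []; _∷_; _++_; map; filter; length; lookup; upTo; allFin; cartesianProduct; cartesianProductWith)
import Data.List.Extrema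
open import Data.List.Membership.Propositional using (_∈_)
open import Data.List.Membership.Propositional.Properties
  using (∈-map⁺; ∈-map⁻; ∈-filter⁺; ∈-filter⁻; ∈-cartesianProduct⁺; ∈-cartesianProductWith⁺;
         ∈-allFin; ∈-upTo⁺; ∈-upTo⁻; ∈-++⁺ˡ; ∈-++⁺ʳ; ∈-++⁻; ∈-lookup)
open import Data.List.Membership.Propositional.Properties.WithK using (unique∧set⇒bag)
open import Data.List.Properties using (map-∘; map-cong; map-++; filter-++; length-map)
open import Data.List.Relation.Binary.BagAndSetEquality using (∼bag⇒↭)
open import Data.List.Relation.Binary.Permutation.Propositional using (_↭_)
open import Data.List.Relation.Binary.Permutation.Propositional.Properties using (map⁺)
open import Data.List.Relation.Unary.All as All using (All; []; _∷_)
open import Data.List.Relation.Unary.All.Properties using (all-filter)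
open import Data.List.Relation.Unary.AllPairs using ([]; _∷_)
open import Data.List.Relation.Unary.Any using (here)
open import Data.List.Relation.Unary.Linked using ([-]; _∷_)
open import Data.List.Relation.Unary.Unique.Propositional using (Unique)
import Data.List.Relation.Unary.Unique.Propositional.Properties as Unique
open import Data.Nat.Base
  using (ℕ; zero; suc; _+_; _*_; _∸_; _≤_; _<_; z≤n; s≤s; s≤s⁻¹;
         NonZero; >-nonZero)
open import Data.Nat.Coprimality using (1-coprimeTo) renaming (sym to coprime-sym)
open import Data.Nat.Induction using (<-rec)
open import Data.Nat.ListAction using (sum)
open import Data.Nat.ListAction.Properties using (sum-++; sum-↭)
open import Data.Nat.Properties
open import Data.Nat.Tactic.RingSolver using (solve-∀)
open import Data.Product.Base using (_×_; _,_; proj₁; proj₂; ∃-syntax; swap; uncurry)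
open import Data.Rational.Base as ℚ using (ℚ; mkℚ; floor; ceiling; *≤*)
import Data.Rational.Properties as ℚ
open import Data.Rational.Unnormalised.Base using (mkℚᵘ; *≡*)
open import Data.Sum.Base using (_⊎_; inj₁; inj₂)
open import Data.Sum.Properties using (inj₁-injective; inj₂-injective)
open import Data.Vec.Functional as Vector using (Vector)
open import Function.Base using (_∘_)
open import Function.Bundles using (mk⇔; Equivalence)
open import Function.Definitions using (Injective)
open import Level using (0ℓ)
open import Relation.Binary.Bundles using (TotalOrder; module DecTotalOrder)
import Relation.Binary.Construct.Flip.EqAndOrd as Flip
open import Relation.Binary.Definitions using (tri<; tri≈; tri>)
open import Relation.Binary.PropositionalEquality hiding ([_])
open import Relation.Nullary using (¬_; Dec; yes; no; contradiction)
open import Relation.Nullary.Decidable using (_×-dec_; _→-dec_; map′; recompute)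
open import Relation.Unary using (Pred; Decidable)

-- Integers among the rationals, floor and ceiling.

fromInt : ℤ → ℚ
fromInt i = mkℚ i 0 (coprime-sym (1-coprimeTo _))

fromInt-neg : ∀ i → fromInt (ℤ.- i) ≡ ℚ.- fromInt i
fromInt-neg (+ zero)  = refl
fromInt-neg (+ suc n) = refl
fromInt-neg -[1+ n ]  = refl

[n*d]/d≡n : ∀ n d .{{_ : NonZero d}} → (+ (n * d)) ℚ./ d ≡ fromInt (+ n)
[n*d]/d≡n n d@(suc d-1) = begin
  (+ (n * d)) ℚ./ d             ≡⟨ ℚ.fromℚᵘ-cong {mkℚᵘ (+ (n * d)) d-1} {mkℚᵘ (+ n) 0} (*≡* eq) ⟩
  (+ n) ℚ./ 1                   ≡⟨ ℚ.↥p/↧p≡p (fromInt (+ n)) ⟩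
  fromInt (+ n)                 ∎
  where
  open ≡-Reasoning
  eq : + (n * d) ℤ.* + 1 ≡ + n ℤ.* + d
  eq = trans (ℤ.*-identityʳ (+ (n * d))) (ℤ.pos-* n d)

-- For `x` = n/d the hypothesis unfolds to i * d ≤ n, and n is less than (n div d + 1) * d;
-- cancelling d leaves i < n div d + 1.
≤-floor : ∀ i x → fromInt i ℚ.≤ x → i ℤ.≤ floor x
≤-floor i (mkℚ n d-1 _) (*≤* i*d≤n*1) =
  subst (i ℤ.≤_) (sym (ℤ.div-pos-is-/ℕ n d))
    (subst (i ℤ.≤_) (ℤ.pred-suc (n ℤ./ℕ d)) (ℤ.i<j⇒i≤pred[j] i<suc))
  where
  d = suc d-1
  i<suc : i ℤ.< ℤ.suc (n ℤ./ℕ d)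
  i<suc = ℤ.*-cancelʳ-<-nonNeg (+ d)
    (ℤ.≤-<-trans (subst (i ℤ.* + d ℤ.≤_) (ℤ.*-identityʳ n) i*d≤n*1) (ℤ.n<s[n/ℕd]*d n d))

-- Dual to `≤-floor`, because the ceiling of `x` is the negated floor of the negated `x`.
ceiling-≤ : ∀ i x → x ℚ.≤ fromInt i → ceiling x ℤ.≤ i
ceiling-≤ i x@(mkℚ _ _ _) x≤i =
  subst (ceiling x ℤ.≤_) (ℤ.neg-involutive i)
    (ℤ.neg-mono-≤ (≤-floor (ℤ.- i) (ℚ.- x)
      (subst (ℚ._≤ ℚ.- x) (sym (fromInt-neg i)) (ℚ.neg-antimono-≤ x≤i))))

-- Extrema over finitely many vectors, and decidability of bijectivity.

allVectors : {A : Set} (n : ℕ) → List A → List (Vector A n)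
allVectors zero    ys = Vector.[] ∷ []
allVectors (suc n) ys = cartesianProductWith Vector._∷_ ys (allVectors n ys)

∈-allVectors : {A : Set} {n : ℕ} {ys : List A} (f : Vector A n) → (∀ i → f i ∈ ys) →
  ∃[ f′ ] f′ ∈ allVectors n ys × f ≗ f′
∈-allVectors {n = zero}  f f∈ys = Vector.[] , here refl , λ ()
∈-allVectors {n = suc n} f f∈ys
  with f′ , f′∈ , f≗f′ ← ∈-allVectors (f ∘ Fin.suc) (f∈ys ∘ Fin.suc) =
  f Fin.zero Vector.∷ f′ ,
  ∈-cartesianProductWith⁺ Vector._∷_ (f∈ys Fin.zero) f′∈ ,
  λ { Fin.zero → refl ; (Fin.suc i) → f≗f′ i }

-- Without function extensionality, a finite list exhausts the vectors only up to
-- pointwise equality, which P and F must therefore respect.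
least : ∀ {a ℓ₁ ℓ₂} (O : TotalOrder a ℓ₁ ℓ₂) →
  let open TotalOrder O using () renaming (Carrier to B; _≤_ to _⊑_) in
  {A : Set} {n : ℕ} (ys : List A)
  {P : Pred (Vector A n) 0ℓ} → Decidable P → (∀ {f g} → f ≗ g → P f → P g) →
  (∀ {f} → P f → ∀ i → f i ∈ ys) →
  (F : Vector A n → B) → (∀ {f g} → f ≗ g → F f ≡ F g) →
  ∃[ f ] P f → ∃[ f ] P f × (∀ g → P g → F f ⊑ F g)
least O {n = n} ys {P} P? P-resp P⇒∈ F F-resp (f₀ , Pf₀) =
  -- `f₀` is the starting value of `argmin`. It satisfies `P`, as does every candidate, so the
  -- result does too.
  argmin F f₀ candidates ,
  argmin-all F Pf₀ (all-filter P? (allVectors n ys)) ,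
  minimal
  where
  open TotalOrder O using () renaming (_≤_ to _⊑_)
  open Data.List.Extrema O
  candidates = filter P? (allVectors n ys)
  minimal : ∀ g → P g → F (argmin F f₀ candidates) ⊑ F g
  minimal g Pg with g′ , g′∈ , g≗g′ ← ∈-allVectors g (P⇒∈ Pg) =
    subst (F (argmin F f₀ candidates) ⊑_) (sym (F-resp g≗g′))
      (All.lookup (f[argmin]≤f[xs] {f = F} f₀ candidates)
        (∈-filter⁺ P? g′∈ (P-resp g≗g′ Pg)))

bijectiveOnto? : ∀ {n} (g : Fin n → ℕ) → Dec (BijectiveOnto [ 1 , n ] g)
bijectiveOnto? {n} g =
  all? (λ x → (1 ≤? g x) ×-dec (g x ≤? n)) ×-dec injective? ×-dec surjective?
  where
  injective? : Dec (Injective _≡_ _≡_ g)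
  injective? = map′ (λ inj {x} {y} → inj x y) (λ inj x y → inj {x} {y})
    (all? λ x → all? λ y → (g x ≟ g y) →-dec (x Fin.≟ y))
  surjective? : Dec (∀ y → [ 1 , n ] y → ∃[ x ] g x ≡ y)
  -- The successors of `toℕ i` for `i` in `Fin n` run through exactly the targets 1, ..., n.
  surjective? = map′ to from (all? λ i → any? λ x → g x ≟ suc (toℕ i))
    where
    to : (∀ i → ∃[ x ] g x ≡ suc (toℕ i)) → ∀ y → [ 1 , n ] y → ∃[ x ] g x ≡ y
    to hit (suc y) (_ , y<n) with x , gx≡ ← hit (fromℕ< y<n) =
      x , trans gx≡ (cong suc (toℕ-fromℕ< y<n))
    from : (∀ y → [ 1 , n ] y → ∃[ x ] g x ≡ y) → ∀ i → ∃[ x ] g x ≡ suc (toℕ i)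
    from hit i = hit (suc (toℕ i)) (s≤s z≤n , toℕ<n i)

bijectiveOnto-resp-≗ : {A B : Set} {T : Pred B 0ℓ} {f g : A → B} → f ≗ g →
  BijectiveOnto T f → BijectiveOnto T g
bijectiveOnto-resp-≗ {T = T} f≗g (into , inj , onto) =
  (λ x → subst T (f≗g x) (into x)) ,
  (λ {x} {y} gx≡gy → inj (trans (f≗g x) (trans gx≡gy (sym (f≗g y))))) ,
  (λ y y∈T → let x , fx≡y = onto y y∈T in x , trans (sym (f≗g x)) fx≡y)

-- Duplicate-free lists, sums over lists, and sums of two distinct labels.

unique∧⇔⇒↭ : {A : Set} {xs ys : List A} → Unique xs → Unique ys →
  (∀ {x} → x ∈ xs → x ∈ ys) → (∀ {x} → x ∈ ys → x ∈ xs) → xs ↭ ys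
unique∧⇔⇒↭ uxs uys to from = ∼bag⇒↭ (unique∧set⇒bag uxs uys (mk⇔ to from))

lookup-injective : {A : Set} {xs : List A} → Unique xs → Injective _≡_ _≡_ (lookup xs)
lookup-injective (x∉xs ∷ _)  {Fin.zero}  {Fin.zero}  _  = refl
lookup-injective {xs = _ ∷ xs} (x∉xs ∷ _)  {Fin.zero}  {Fin.suc j} eq =
  contradiction eq (All.lookup x∉xs (∈-lookup j))
lookup-injective (x∉xs ∷ _)  {Fin.suc i} {Fin.zero}  eq =
  contradiction (sym eq) (All.lookup x∉xs (∈-lookup i))
lookup-injective (_ ∷ uxs) {Fin.suc i} {Fin.suc j} eq =
  cong Fin.suc (lookup-injective uxs eq)

-- Pigeonhole: `lookup` injects the positions of the list into `Fin n`.
unique⇒length≤ : ∀ {n} {xs : List (Fin n)} → Unique xs → length xs ≤ n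
unique⇒length≤ uxs = injective⇒≤ (lookup-injective uxs)

+-interchange : ∀ a b c d → a + b + (c + d) ≡ a + c + (b + d)
+-interchange = solve-∀

sum-map-+ : {A : Set} (f g : A → ℕ) (xs : List A) →
  sum (map (λ x → f x + g x) xs) ≡ sum (map f xs) + sum (map g xs)
sum-map-+ f g []       = refl
sum-map-+ f g (x ∷ xs) = trans (cong₂ _+_ refl (sum-map-+ f g xs))
  (+-interchange (f x) (g x) (sum (map f xs)) (sum (map g xs)))

sum-map-constant : {A : Set} {f : A → ℕ} {c : ℕ} → (∀ x → f x ≡ c) →
  ∀ xs → sum (map f xs) ≡ c * length xs
sum-map-constant {c = c} f≡c []       = sym (*-zeroʳ c)
sum-map-constant {c = c} f≡c (x ∷ xs) =
  trans (cong₂ _+_ (f≡c x) (sum-map-constant f≡c xs)) (sym (*-suc c (length xs)))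

-- Counting row by row: each `x` contributes `w x` once for every `y` related to it. With adjacency
-- as the relation, the row lengths are the degrees.
sum-over-relation : {A B : Set} {R : A → B → Set} (R? : ∀ x y → Dec (R x y))
  (w : A → ℕ) (xs : List A) (ys : List B) →
  sum (map (w ∘ proj₁) (filter (uncurry R?) (cartesianProduct xs ys))) ≡
  sum (map (λ x → length (filter (R? x) ys) * w x) xs)
sum-over-relation R? w []       ys = refl
sum-over-relation {A} {B} R? w (x ∷ xs) ys = begin
  total (map (x ,_) ys ++ rest)           ≡⟨ total-++ (map (x ,_) ys) rest ⟩
  total (map (x ,_) ys) + total rest      ≡⟨ cong₂ _+_ (row ys) (sum-over-relation R? w xs ys) ⟩
  sum (map (λ x → length (filter (R? x) ys) * w x) (x ∷ xs)) ∎
  where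
  open ≡-Reasoning
  rest = cartesianProduct xs ys
  total : List (A × B) → ℕ
  total ps = sum (map (w ∘ proj₁) (filter (uncurry R?) ps))
  total-++ : ∀ ps qs → total (ps ++ qs) ≡ total ps + total qs
  total-++ ps qs = begin
    total (ps ++ qs)
      ≡⟨ cong (sum ∘ map (w ∘ proj₁)) (filter-++ (uncurry R?) ps qs) ⟩
    sum (map (w ∘ proj₁) (filter (uncurry R?) ps ++ filter (uncurry R?) qs))
      ≡⟨ cong sum (map-++ (w ∘ proj₁) (filter (uncurry R?) ps) _) ⟩
    sum (map (w ∘ proj₁) (filter (uncurry R?) ps) ++ map (w ∘ proj₁) (filter (uncurry R?) qs))
      ≡⟨ sum-++ (map (w ∘ proj₁) (filter (uncurry R?) ps)) _ ⟩
    total ps + total qs ∎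
  row : ∀ zs → total (map (x ,_) zs) ≡ length (filter (R? x) zs) * w x
  row []       = refl
  row (z ∷ zs) with R? x z
  ... | yes _ = cong₂ _+_ refl (row zs)
  ... | no  _ = row zs

distinct⇒3≤sum : ∀ {a b} → 1 ≤ a → 1 ≤ b → a ≢ b → 3 ≤ a + b
distinct⇒3≤sum {a} {b} 1≤a 1≤b a≢b with <-cmp a b
... | tri< a<b _ _ = +-mono-≤ 1≤a (≤-trans (s≤s 1≤a) a<b)
... | tri≈ _ a≡b _ = contradiction a≡b a≢b
... | tri> _ _ b<a = +-mono-≤ (≤-trans (s≤s 1≤b) b<a) 1≤b

distinct⇒sum<2* : ∀ {a b n} → a ≤ n → b ≤ n → a ≢ b → a + b < 2 * n
distinct⇒sum<2* {a} {b} {n} a≤n b≤n a≢b rewrite +-identityʳ n with <-cmp a b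
... | tri< a<b _ _ = +-mono-<-≤ (<-≤-trans a<b b≤n) b≤n
... | tri≈ _ a≡b _ = contradiction a≡b a≢b
... | tri> _ _ b<a = +-mono-≤-< a≤n (<-≤-trans b<a a≤n)

-- Girth, triangles and consecutive label sums.

module _ (G : Graph) where
  open Graph G

  TriangleFree : Set
  TriangleFree = ∀ {u v w} → u ~ v → v ~ w → w ~ u → ⊥

  -- A triangle would be a cycle of length 3; its vertices are distinct because adjacency is
  -- irreflexive.
  girth>3⇒triangleFree : ∀ {g} → IsGirth g → 3 < g → TriangleFree
  girth>3⇒triangleFree (_ , g≤) 3<g {u} {v} {w} u~v v~w w~u = <⇒≱ 3<g (g≤ 3
    (u ∷ v ∷ w ∷ [] ,
     (≤-refl ,
      ((λ eq → ~-irrefl eq u~v) ∷ (λ eq → ~-irrefl (sym eq) w~u) ∷ []) ∷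
        ((λ eq → ~-irrefl eq v~w) ∷ []) ∷ [] ∷ [] ,
      u~v ∷ v~w ∷ w~u ∷ [-]) ,
     refl))

  -- A cycle attaining the girth is a repetition-free list of vertices.
  girth≤order : ∀ {g} → IsGirth g → g ≤ order
  girth≤order ((_ ∷ _ , (_ , unique , _) , refl) , _) = unique⇒length≤ unique

  -- The vertex labelled 1 turns out to be adjacent to all others, so any edge avoiding it closes a
  -- triangle. The edge of sum `2 + order` is such an edge: a label 1 would force the other label to
  -- be `1 + order`.
  initialSums⇒triangle : 1 ≤ order → TriangleFree → (h : V → ℕ) → Injective _≡_ _≡_ h →
    (∀ v → [ 1 , order ] (h v)) →
    ¬ (∀ n → 3 ≤ n → n ≤ 2 + order → ∃[ u ] ∃[ v ] u ~ v × h u + h v ≡ n)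
  initialSums⇒triangle 1≤order noTriangle h h-inj h-range sums =
    let u , v , u~v , hu+hv≡ = sums (2 + order) (s≤s (s≤s 1≤order)) ≤-refl
    in joinedByStar u~v
         (2≤ hu+hv≡ (proj₂ (h-range v)))
         (2≤ (trans (+-comm (h v) (h u)) hu+hv≡) (proj₂ (h-range u)))
         (star (h u)) (star (h v))
    where
    Joined : ℕ → Set
    Joined m = 2 ≤ m → m ≤ order → ∃[ u ] ∃[ v ] u ~ v × h u ≡ 1 × h v ≡ m

    2≤ : ∀ {a b} → a + b ≡ 2 + order → b ≤ order → 2 ≤ a
    2≤ {a} {b} eq b≤ = +-cancelʳ-≤ order 2 a (≤-trans (≤-reflexive (sym eq)) (+-monoʳ-≤ a b≤))

    -- Injectivity of `h` identifies the two witnesses of label 1, and the far ends with `u` and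
    -- `v`; these three vertices form a triangle.
    joinedByStar : ∀ {u v} → u ~ v → 2 ≤ h u → 2 ≤ h v → Joined (h u) → Joined (h v) → ⊥
    joinedByStar {u} {v} u~v 2≤hu 2≤hv joined-u joined-v
      with c , u′ , c~u′ , hc≡1 , hu′≡hu ← joined-u 2≤hu (proj₂ (h-range u))
         | d , v′ , d~v′ , hd≡1 , hv′≡hv ← joined-v 2≤hv (proj₂ (h-range v))
      with refl ← h-inj (trans hc≡1 (sym hd≡1)) | refl ← h-inj hu′≡hu | refl ← h-inj hv′≡hv =
      noTriangle c~u′ u~v (~-sym d~v′)

    star : ∀ m → Joined m
    star = <-rec Joined step
      where
      step : ∀ m → (∀ {l} → l < m → Joined l) → Joined m
      step m rec 2≤m m≤order
        -- If the edge of sum m + 1 uses label 1, its other label is m, as desired. Otherwise both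
        -- labels are at least 2, hence below m, and the induction hypothesis joins both ends to the
        -- vertex labelled 1.
        with u , v , u~v , hu+hv≡ ← sums (suc m) (s≤s 2≤m) (≤-trans (s≤s m≤order) (n≤1+n _))
        with h u ≟ 1 | h v ≟ 1
      ... | yes hu≡1 | _ = u , v , u~v , hu≡1 ,
            suc-injective (trans (cong (_+ h v) (sym hu≡1)) hu+hv≡)
      ... | no _ | yes hv≡1 = v , u , ~-sym u~v , hv≡1 ,
            suc-injective (trans (cong (_+ h u) (sym hv≡1)) (trans (+-comm (h v) (h u)) hu+hv≡))
      ... | no hu≢1 | no hv≢1 =
            ⊥-elim (joinedByStar u~v 2≤hu 2≤hv (rec (<m 2≤hv hu+hv≡))
              (rec (<m 2≤hu (trans (+-comm (h v) (h u)) hu+hv≡))))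
        where
        2≤hu = ≤∧≢⇒< (proj₁ (h-range u)) (hu≢1 ∘ sym)
        2≤hv = ≤∧≢⇒< (proj₁ (h-range v)) (hv≢1 ∘ sym)
        <m : ∀ {a b} → 2 ≤ b → a + b ≡ suc m → a < m
        <m {a} {b} 2≤b eq = s≤s⁻¹ (begin
          2 + a ≡⟨ +-comm 2 a ⟩
          a + 2 ≤⟨ +-monoʳ-≤ a 2≤b ⟩
          a + b ≡⟨ eq ⟩
          suc m ∎)
          where open ≤-Reasoning

  -- Enumeration of the edges and the degree sum.

  IsEdgePair : V × V → Set
  IsEdgePair (u , v) = u Fin.< v × u ~ v

  isEdgePair? : Decidable IsEdgePair
  isEdgePair? (u , v) = (u Fin.<? v) ×-dec (u ~? v)

  vertexPairs : List (V × V)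
  vertexPairs = cartesianProduct (allFin order) (allFin order)

  ∈-vertexPairs : ∀ uv → uv ∈ vertexPairs
  ∈-vertexPairs _ = ∈-cartesianProduct⁺ (∈-allFin _) (∈-allFin _)

  vertexPairs-unique : Unique vertexPairs
  vertexPairs-unique = Unique.cartesianProduct⁺ (Unique.allFin⁺ order) (Unique.allFin⁺ order)

  -- The same filtered list as in the definition of `size`, so `size` is its length by computation.
  edgePairs : List (V × V)
  edgePairs = filter isEdgePair? vertexPairs

  ∈-edgePairs⁺ : ∀ {u v} → u Fin.< v → u ~ v → (u , v) ∈ edgePairs
  ∈-edgePairs⁺ u<v u~v = ∈-filter⁺ isEdgePair? (∈-vertexPairs _) (u<v , u~v)

  ∈-edgePairs⁻ : ∀ {u v} → (u , v) ∈ edgePairs → u Fin.< v × u ~ v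
  ∈-edgePairs⁻ = proj₂ ∘ ∈-filter⁻ isEdgePair? {xs = vertexPairs}

  edgePairs-unique : Unique edgePairs
  edgePairs-unique = Unique.filter⁺ isEdgePair? vertexPairs-unique

  endpoints : E → V × V
  endpoints e = E.src e , E.tgt e

  endpoints-injective : Injective _≡_ _≡_ endpoints
  endpoints-injective {edge _ _ _ _} {edge _ _ _ _} refl = refl

  -- The fields of `E` are irrelevant; decidability recovers usable proofs.
  src<tgt : ∀ e → E.src e Fin.< E.tgt e
  src<tgt (edge u v u<v _) = recompute (u Fin.<? v) u<v

  src~tgt : ∀ e → E.src e ~ E.tgt e
  src~tgt (edge u v _ u~v) = recompute (u ~? v) u~v

  toEdge : ∀ {uv} → IsEdgePair uv → E
  toEdge (u<v , u~v) = edge _ _ u<v u~v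

  edges : List E
  edges = All.reduce toEdge (all-filter isEdgePair? vertexPairs)

  map-endpoints-edges : map endpoints edges ≡ edgePairs
  map-endpoints-edges = map-endpoints-reduce _
    where
    map-endpoints-reduce : ∀ {ps} (pps : All IsEdgePair ps) →
      map endpoints (All.reduce toEdge pps) ≡ ps
    map-endpoints-reduce []        = refl
    map-endpoints-reduce (_ ∷ pps) = cong (_ ∷_) (map-endpoints-reduce pps)

  length-edges : length edges ≡ size
  length-edges = trans (sym (length-map endpoints edges)) (cong length map-endpoints-edges)

  edges-unique : Unique edges
  edges-unique = Unique.map⁻ (subst Unique (sym map-endpoints-edges) edgePairs-unique)

  ∈-edges : ∀ e → e ∈ edges
  ∈-edges e
    with e′ , e′∈ , eq ← ∈-map⁻ endpoints
           (subst (endpoints e ∈_) (sym map-endpoints-edges) (∈-edgePairs⁺ (src<tgt e) (src~tgt e))) =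
    subst (_∈ edges) (sym (endpoints-injective eq)) e′∈

  arcs : List (V × V)
  arcs = filter (uncurry _~?_) vertexPairs

  -- Every arc runs either upwards or downwards, since there are no loops. Both lists are
  -- duplicate-free, so having the same elements suffices.
  arcs↭edgePairs++swapped : arcs ↭ edgePairs ++ map swap edgePairs
  arcs↭edgePairs++swapped = unique∧⇔⇒↭
    (Unique.filter⁺ (uncurry _~?_) vertexPairs-unique)
    (Unique.++⁺ edgePairs-unique (Unique.map⁺ (cong swap) edgePairs-unique) disjoint)
    to from
    where
    disjoint : ∀ {uv} → ¬ (uv ∈ edgePairs × uv ∈ map swap edgePairs)
    disjoint (uv∈ , uv∈swapped) with (v , u) , vu∈ , refl ← ∈-map⁻ swap uv∈swapped =
      <-asym (proj₁ (∈-edgePairs⁻ uv∈)) (proj₁ (∈-edgePairs⁻ vu∈))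

    to : ∀ {uv} → uv ∈ arcs → uv ∈ edgePairs ++ map swap edgePairs
    to {u , v} uv∈
      with u~v ← proj₂ (∈-filter⁻ (uncurry _~?_) {xs = vertexPairs} uv∈)
      with Fin.<-cmp u v
    ... | tri< u<v _ _ = ∈-++⁺ˡ (∈-edgePairs⁺ u<v u~v)
    ... | tri≈ _ u≡v _ = contradiction u~v (~-irrefl u≡v)
    ... | tri> _ _ v<u = ∈-++⁺ʳ edgePairs (∈-map⁺ swap (∈-edgePairs⁺ v<u (~-sym u~v)))

    ∈-arcs : ∀ {u v} → u ~ v → (u , v) ∈ arcs
    ∈-arcs = ∈-filter⁺ (uncurry _~?_) (∈-vertexPairs _)

    from : ∀ {uv} → uv ∈ edgePairs ++ map swap edgePairs → uv ∈ arcs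
    from uv∈ with ∈-++⁻ edgePairs uv∈
    ... | inj₁ uv∈pairs = ∈-arcs (proj₂ (∈-edgePairs⁻ uv∈pairs))
    ... | inj₂ uv∈swapped with (v , u) , vu∈ , refl ← ∈-map⁻ swap uv∈swapped =
      ∈-arcs (~-sym (proj₂ (∈-edgePairs⁻ vu∈)))

  -- Double counting as in the handshake lemma: both sides sum `g` over the starting points of all
  -- arcs, and each edge carries two opposite arcs.
  sum-deg : (g : V → ℕ) →
    sum (map (λ u → deg u * g u) (allFin order)) ≡
    sum (map (λ e → g (E.src e) + g (E.tgt e)) edges)
  sum-deg g = begin
    sum (map (λ u → deg u * g u) (allFin order))
      ≡⟨ sum-over-relation _~?_ g (allFin order) (allFin order) ⟨
    sum (map (g ∘ proj₁) arcs)
      ≡⟨ sum-↭ (map⁺ (g ∘ proj₁) arcs↭edgePairs++swapped) ⟩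
    sum (map (g ∘ proj₁) (edgePairs ++ map swap edgePairs))
      ≡⟨ cong sum (map-++ (g ∘ proj₁) edgePairs (map swap edgePairs)) ⟩
    sum (map (g ∘ proj₁) edgePairs ++ map (g ∘ proj₁) (map swap edgePairs))
      ≡⟨ sum-++ (map (g ∘ proj₁) edgePairs) _ ⟩
    sum (map (g ∘ proj₁) edgePairs) + sum (map (g ∘ proj₁) (map swap edgePairs))
      ≡⟨ cong (λ ns → sum (map (g ∘ proj₁) edgePairs) + sum ns) (map-∘ edgePairs) ⟨
    sum (map (g ∘ proj₁) edgePairs) + sum (map (g ∘ proj₂) edgePairs)
      ≡⟨ sum-map-+ (g ∘ proj₁) (g ∘ proj₂) edgePairs ⟨
    sum (map (λ (u , v) → g u + g v) edgePairs)
      ≡⟨ cong (λ ps → sum (map (λ (u , v) → g u + g v) ps)) map-endpoints-edges ⟨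
    sum (map (λ (u , v) → g u + g v) (map endpoints edges))
      ≡⟨ cong sum (map-∘ edges) ⟨
    sum (map (λ e → g (E.src e) + g (E.tgt e)) edges) ∎
    where open ≡-Reasoning

  size-positive : 5 ≤ order → size + 5 ≡ 2 * order → 1 ≤ size
  size-positive 5≤order size+5≡2*order = ≤-trans (s≤s z≤n) (+-cancelʳ-≤ 5 5 size
    (subst (10 ≤_) (sym size+5≡2*order) (*-monoʳ-≤ 2 5≤order)))

  S-value : .{{NonZero size}} → (V → ℕ) → ℚ
  S-value g = (+ SNumerator g) ℚ./ size

  S-value-resp-≗ : .{{_ : NonZero size}} → ∀ {g h} → g ≗ h → S-value g ≡ S-value h
  S-value-resp-≗ g≗h = cong (λ n → (+ (n + _)) ℚ./ size)
    (cong sum (map-cong (λ u → cong (deg u *_) (g≗h u)) (allFin order)))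

  -- Valence of a super edge-magic labeling.

  module SuperLabeling (f : V ⊎ E → ℕ) (super : IsSuperEdgeMagicLabeling f)
    (k : ℤ) (valence : HasValence f k) where

    private
      onto-all : BijectiveOnto [ 1 , order + size ] f
      onto-all = proj₁ (proj₁ super)

      f-injective : Injective _≡_ _≡_ f
      f-injective = proj₁ (proj₂ onto-all)

    vertexLabel : V → ℕ
    vertexLabel = f ∘ inj₁

    vertexLabel-range : ∀ v → [ 1 , order ] (vertexLabel v)
    vertexLabel-range v = Equivalence.to (proj₂ super _) (v , refl)

    vertexLabel-bijective : BijectiveOnto [ 1 , order ] vertexLabel
    vertexLabel-bijective =
      vertexLabel-range , inj₁-injective ∘ f-injective ,
      λ y → Equivalence.from (proj₂ super y)

    -- The labels up to `order` are all taken by vertices, and `f` is injective.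
    order<edgeLabel : ∀ e → order < f (inj₂ e)
    order<edgeLabel e = ≰⇒> λ fe≤order →
      let v , fv≡fe = proj₂ (proj₂ vertexLabel-bijective) _ (proj₁ (proj₁ onto-all (inj₂ e)) , fe≤order)
      in contradiction (f-injective fv≡fe) λ ()

    edgeLabel-onto : ∀ j → 1 ≤ j → j ≤ size → ∃[ e ] f (inj₂ e) ≡ order + j
    edgeLabel-onto j 1≤j j≤size
      with proj₂ (proj₂ onto-all) (order + j)
             (≤-trans 1≤j (m≤n+m j order) , +-monoʳ-≤ order j≤size)
    ... | inj₂ e , eq = e , eq
    ... | inj₁ v , eq = contradiction (proj₂ (vertexLabel-range v))
      (<⇒≱ (subst (order <_) (sym eq) (m<m+n order 1≤j)))

    -- Turns the sum of the edge labels into the second summand of `SNumerator`.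
    edgeLabels↭ : map (f ∘ inj₂) edges ↭ map (λ i → order + suc i) (upTo size)
    edgeLabels↭ = unique∧⇔⇒↭
      (Unique.map⁺ (inj₂-injective ∘ f-injective) edges-unique)
      (Unique.map⁺ (suc-injective ∘ +-cancelˡ-≡ order _ _) (Unique.upTo⁺ size))
      to from
      where
      to : ∀ {x} → x ∈ map (f ∘ inj₂) edges → x ∈ map (λ i → order + suc i) (upTo size)
      to x∈ with e , _ , refl ← ∈-map⁻ (f ∘ inj₂) x∈
        with i , eq ← m≤n⇒∃[o]m+o≡n (order<edgeLabel e) =
        subst (_∈ map (λ i → order + suc i) (upTo size)) order+suc[i]≡
          (∈-map⁺ (λ i → order + suc i) (∈-upTo⁺ (+-cancelˡ-≤ order (suc i) size
            (subst (_≤ order + size) (sym order+suc[i]≡) (proj₂ (proj₁ onto-all (inj₂ e)))))))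
        where
        order+suc[i]≡ : order + suc i ≡ f (inj₂ e)
        order+suc[i]≡ = trans (+-suc order i) eq
      from : ∀ {x} → x ∈ map (λ i → order + suc i) (upTo size) → x ∈ map (f ∘ inj₂) edges
      from x∈ with i , i∈ , refl ← ∈-map⁻ (λ i → order + suc i) x∈
        with e , eq ← edgeLabel-onto (suc i) (s≤s z≤n) (∈-upTo⁻ i∈) =
        subst (_∈ map (f ∘ inj₂) edges) eq (∈-map⁺ (f ∘ inj₂) (∈-edges e))

    -- Sum the magic condition over all edges: the vertex labels give the degree sum, the edge
    -- labels the remaining term. So the valence is the element of `S` given by `vertexLabel`.
    SNumerator≡ : ∀ {n} → k ≡ + n → SNumerator vertexLabel ≡ n * size
    SNumerator≡ {n} k≡n = begin
      SNumerator vertexLabel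
        ≡⟨ cong₂ _+_ (sum-deg vertexLabel) (sym (sum-↭ edgeLabels↭)) ⟩
      sum (map (λ e → vertexLabel (E.src e) + vertexLabel (E.tgt e)) edges) + sum (map (f ∘ inj₂) edges)
        ≡⟨ sum-map-+ _ (f ∘ inj₂) edges ⟨
      sum (map (λ e → vertexLabel (E.src e) + vertexLabel (E.tgt e) + f (inj₂ e)) edges)
        ≡⟨ sum-map-constant (λ e → ℤ.+-injective (trans (valence e) k≡n)) edges ⟩
      n * length edges
        ≡⟨ cong (n *_) length-edges ⟩
      n * size ∎
      where open ≡-Reasoning

    -- The edge labels fill [order + 1, order + size], so the sums of the labels of
    -- adjacent vertices are the integers s, s + 1, …, s + size ∸ 1.
    valence-offset : 1 ≤ size → ∃[ s ] k ≡ + (order + size + s) ×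
      (∀ j → 1 ≤ j → j ≤ size →
        ∃[ u ] ∃[ v ] u ~ v × vertexLabel u + vertexLabel v + j ≡ size + s)
    valence-offset 1≤size
      -- The largest edge label, `order + size`, belongs to the edge with the least vertex sum; that
      -- sum is `s`.
      with e , fe≡ ← edgeLabel-onto size 1≤size ≤-refl =
      s , k≡ , sums
      where
      s = vertexLabel (E.src e) + vertexLabel (E.tgt e)
      k≡ : k ≡ + (order + size + s)
      k≡ = trans (sym (valence e)) (cong +_ (trans (cong (λ n → s + n) fe≡) (+-comm s (order + size))))
      sums : ∀ j → 1 ≤ j → j ≤ size →
        ∃[ u ] ∃[ v ] u ~ v × vertexLabel u + vertexLabel v + j ≡ size + s
      sums j 1≤j j≤size with e′ , fe′≡ ← edgeLabel-onto j 1≤j j≤size =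
        E.src e′ , E.tgt e′ , src~tgt e′ , +-cancelˡ-≡ order _ _ (begin
          order + (t + j)    ≡⟨ move order t j ⟩
          t + (order + j)    ≡⟨ cong (λ n → t + n) fe′≡ ⟨
          t + f (inj₂ e′)    ≡⟨ ℤ.+-injective (trans (valence e′) k≡) ⟩
          order + size + s   ≡⟨ +-assoc order size s ⟩
          order + (size + s) ∎)
        where
        open ≡-Reasoning
        t = vertexLabel (E.src e′) + vertexLabel (E.tgt e′)
        move : ∀ a b c → a + (b + c) ≡ b + (a + c)
        move = solve-∀

    valence≡ : TriangleFree → 5 ≤ order → size + 5 ≡ 2 * order → k ≡ + (order + size + 4)
    valence≡ noTriangle 5≤order size+5≡2*order
      with 1≤size ← size-positive 5≤order size+5≡2*order
      with s , k≡ , sums ← valence-offset 1≤size =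
      trans k≡ (cong (λ s → + (order + size + s)) s≡4)
      where
      1≤order : 1 ≤ order
      1≤order = ≤-trans (s≤s z≤n) 5≤order

      -- This makes the run of `size` consecutive sums long enough to contain the `order` sums 3,
      -- ..., `2 + order`.
      order≤size : order ≤ size
      order≤size = +-cancelʳ-≤ 5 order size (begin
        order + 5     ≤⟨ +-monoʳ-≤ order 5≤order ⟩
        order + order ≡⟨ cong (λ n → order + n) (+-identityʳ order) ⟨
        2 * order     ≡⟨ size+5≡2*order ⟨
        size + 5      ∎)
        where open ≤-Reasoning

      labels≢ : ∀ {u v} → u ~ v → vertexLabel u ≢ vertexLabel v
      labels≢ u~v eq = ~-irrefl (proj₁ (proj₂ vertexLabel-bijective) eq) u~v

      3≤s : 3 ≤ s
      -- Offset `size` selects the least sum `s`, which is at least 1 + 2.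
      3≤s with u , v , u~v , eq ← sums size 1≤size ≤-refl =
        subst (3 ≤_) (+-cancelˡ-≡ size _ _ (trans (+-comm size _) eq))
          (distinct⇒3≤sum (proj₁ (vertexLabel-range u)) (proj₁ (vertexLabel-range v)) (labels≢ u~v))

      s≤5 : s ≤ 5
      -- Offset 1 selects the greatest sum, `size + s ∸ 1`; it is below `2 * order`, that is,
      -- `size + 5`.
      s≤5 with u , v , u~v , eq ← sums 1 ≤-refl 1≤size =
        +-cancelˡ-≤ size s 5 (subst₂ _≤_ (trans (+-comm 1 _) eq) (sym size+5≡2*order)
          (distinct⇒sum<2* (proj₂ (vertexLabel-range u)) (proj₂ (vertexLabel-range v)) (labels≢ u~v)))

      s≢3 : s ≢ 3
      s≢3 refl = initialSums⇒triangle 1≤order noTriangle vertexLabel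
        (proj₁ (proj₂ vertexLabel-bijective)) vertexLabel-range attained
        where
        attained : ∀ n → 3 ≤ n → n ≤ 2 + order →
          ∃[ u ] ∃[ v ] u ~ v × vertexLabel u + vertexLabel v ≡ n
        attained n 3≤n n≤2+order
          -- For `s` = 3 the edge of sum n has offset `size + 3 ∸ n`, which is `suc o` when n + o =
          -- `2 + size`.
          with o , n+o≡ ← m≤n⇒∃[o]m+o≡n (≤-trans n≤2+order (+-monoʳ-≤ 2 order≤size))
          with u , v , u~v , eq ← sums (suc o) (s≤s z≤n)
                 (s≤s⁻¹ (s≤s⁻¹ (≤-trans (+-monoˡ-≤ o 3≤n) (≤-reflexive n+o≡)))) =
          u , v , u~v , +-cancelʳ-≡ (suc o) _ _ (begin
            vertexLabel u + vertexLabel v + suc o ≡⟨ eq ⟩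
            size + 3                              ≡⟨ +-comm size 3 ⟩
            3 + size                              ≡⟨ cong suc n+o≡ ⟨
            suc (n + o)                           ≡⟨ +-suc n o ⟨
            n + suc o                             ∎)
          where open ≡-Reasoning

      -- The complementary labels order + 1 ∸ x reduce s ≡ 5 to the same lemma.
      s≢5 : s ≢ 5
      s≢5 refl = initialSums⇒triangle 1≤order noTriangle mirrored
        (λ {u} {v} eq → proj₁ (proj₂ vertexLabel-bijective)
          (∸-cancelˡ-≡ (label≤ u) (label≤ v) eq))
        (λ v → m<n⇒0<n∸m (s≤s (proj₂ (vertexLabel-range v))) ,
               ∸-monoʳ-≤ (suc order) (proj₁ (vertexLabel-range v)))
        attained
        where
        mirrored : V → ℕ
        mirrored v = suc order ∸ vertexLabel v

        label≤ : ∀ v → vertexLabel v ≤ suc order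
        label≤ v = m≤n⇒m≤1+n (proj₂ (vertexLabel-range v))

        attained : ∀ n → 3 ≤ n → n ≤ 2 + order →
          ∃[ u ] ∃[ v ] u ~ v × mirrored u + mirrored v ≡ n
        attained (suc (suc j)) (s≤s (s≤s 1≤j)) (s≤s (s≤s j≤order))
          -- For `s` = 5 the sum at offset j is `size + 5 ∸ j`, that is, `2 * order ∸ j`; its mirror
          -- image is `2 + j`.
          with u , v , u~v , eq ← sums j 1≤j (≤-trans j≤order order≤size) =
          u , v , u~v , +-cancelˡ-≡ (vertexLabel u + vertexLabel v) _ _ (begin
            vertexLabel u + vertexLabel v + (mirrored u + mirrored v)
              ≡⟨ +-interchange (vertexLabel u) (vertexLabel v) (mirrored u) (mirrored v) ⟩
            vertexLabel u + mirrored u + (vertexLabel v + mirrored v)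
              ≡⟨ cong₂ _+_ (m+[n∸m]≡n (label≤ u)) (m+[n∸m]≡n (label≤ v)) ⟩
            suc order + suc order
              ≡⟨ double-suc order ⟩
            2 + 2 * order
              ≡⟨ cong (λ n → 2 + n) (trans eq size+5≡2*order) ⟨
            2 + (vertexLabel u + vertexLabel v + j)
              ≡⟨ shift (vertexLabel u + vertexLabel v) j ⟩
            vertexLabel u + vertexLabel v + (2 + j) ∎)
          where
          open ≡-Reasoning
          double-suc : ∀ n → suc n + suc n ≡ 2 + 2 * n
          double-suc = solve-∀
          shift : ∀ a b → 2 + (a + b) ≡ a + (2 + b)
          shift = solve-∀

      s≡4 : s ≡ 4
      s≡4 = ≤-antisym (s≤s⁻¹ (≤∧≢⇒< s≤5 s≢5)) (≤∧≢⇒< 3≤s (s≢3 ∘ sym))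

    -- The valence is itself a value in `S`, so it lies between the extrema, and being an integer it
    -- survives rounding them inwards. The extrema exist because only finitely many bijections
    -- compete.
    valence∈I : ∀ {n} → k ≡ + n → {{NonZero size}} → I k
    valence∈I {n} refl {{size≢0}} = S-value g , S-value h ,
      (fromBijective g g-bij , λ { _ (_ , g′ , g′-bij , refl) → g-least g′ g′-bij }) ,
      (fromBijective h h-bij , λ { _ (_ , g′ , g′-bij , refl) → h-greatest g′ g′-bij }) ,
      ceiling-≤ k (S-value g)
        (subst (S-value g ℚ.≤_) S-value≡k (g-least vertexLabel vertexLabel-bijective)) ,
      ≤-floor k (S-value h)
        (subst (ℚ._≤ S-value h) S-value≡k (h-greatest vertexLabel vertexLabel-bijective))
      where
      fromBijective : ∀ g → BijectiveOnto [ 1 , order ] g → S (S-value g)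
      fromBijective g g-bij = size≢0 , g , g-bij , refl

      S-value≡k : S-value vertexLabel ≡ fromInt k
      S-value≡k = trans (cong (λ m → (+ m) ℚ./ size) (SNumerator≡ refl)) ([n*d]/d≡n n size)

      labels∈ : ∀ {g : V → ℕ} → BijectiveOnto [ 1 , order ] g → ∀ v → g v ∈ upTo (suc order)
      labels∈ g-bij v = ∈-upTo⁺ (s≤s (proj₂ (proj₁ g-bij v)))

      ℚ-totalOrder = DecTotalOrder.totalOrder ℚ.≤-decTotalOrder

      ∃least = least ℚ-totalOrder (upTo (suc order)) bijectiveOnto?
        bijectiveOnto-resp-≗ labels∈ S-value S-value-resp-≗ (vertexLabel , vertexLabel-bijective)
      -- A maximum is a minimum for the reversed order.
      ∃greatest = least (Flip.totalOrder ℚ-totalOrder) (upTo (suc order)) bijectiveOnto?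
        bijectiveOnto-resp-≗ labels∈ S-value S-value-resp-≗ (vertexLabel , vertexLabel-bijective)

      g = proj₁ ∃least
      g-bij = proj₁ (proj₂ ∃least)
      g-least = proj₂ (proj₂ ∃least)
      h = proj₁ ∃greatest
      h-bij = proj₁ (proj₂ ∃greatest)
      h-greatest = proj₂ (proj₂ ∃greatest)

-- The super edge-magic set as a singleton.

theorem2p4 : (G : Graph) → let open Graph G in
    IsSuperEdgeMagic →
    ContainsCycle →
    size + 5 ≡ 2 * order →
    (g : ℕ) → IsGirth g → 5 ≤ g →
    HasCardinality σ 1
theorem2p4 G (f , super@((_ , k , valence) , _)) _ size+5≡2*order g isGirth 5≤g =
  + K ∷ [] , [] ∷ [] , refl , λ i → mk⇔
    -- The given labeling realises `K`, which puts `K` into the set; conversely, every super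
    -- edge-magic labeling has valence `K`.
    (λ { (here refl) →
         SuperLabeling.valence∈I G f super (+ K) valence-K refl , f , super , valence-K })
    (λ { (_ , f′ , super′ , valence′) → here (valence≡K f′ super′ i valence′) })
  where
  open Graph G
  K = order + size + 4
  5≤order : 5 ≤ order
  5≤order = ≤-trans 5≤g (girth≤order G isGirth)
  valence≡K : ∀ f → IsSuperEdgeMagicLabeling f → ∀ k → HasValence f k → k ≡ + K
  valence≡K f super k valence = SuperLabeling.valence≡ G f super k valence
    (girth>3⇒triangleFree G isGirth (≤-trans (n≤1+n 4) 5≤g))
    5≤order size+5≡2*order
  valence-K : HasValence f (+ K)
  valence-K = subst (HasValence f) (valence≡K f super k valence) valence
  instance
    size≢0 : NonZero size
    size≢0 = >-nonZero (size-positive G 5≤order size+5≡2*order)
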